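{- Define the sequence $s_{18}(n)$ by $s_{18}(0)=1$ and, for $n \geq 1$, \[ s_{18}(n) = \sum_{k=0}^{\lfloor n/3 \rfloor} (-1)^k \binom{n}{k}\binom{2k}{k}\binom{2(n-k)}{n-k}\left[\binom{2n-3k-1}{n} + \binom{2n-3k}{n}\right]. \] Then for all integers $m \geq 1$, $r \geq 1$ and all primes $p$, \[ s_{18}(m p^r) \equiv s_{18}(m p^{r-1}) \pmod{p^{2r}}. \]
   Context: $\lfloor x\rfloor$ denotes the largest integer not exceeding $x$. Binomial coefficients $\binom{a}{b}$ with integers $0 \le a < b$ are $0$. -}

module Defs where

open import Data.Nat as ℕ using (ℕ; zero; suc; _∸_)
open import Data.Nat.DivMod using (_/_)
open import Data.Nat.Combinatorics using (_C_)
open import Data.Integer as ℤ using (ℤ; +_)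

sgn : ℕ → ℤ
sgn zero = ℤ.+ 1
sgn (suc k) = ℤ.- (sgn k)

sumTo : ℕ → (ℕ → ℤ) → ℤ
sumTo zero f = f 0
sumTo (suc N) f = sumTo N f ℤ.+ f (suc N)

-- the summand for given n and k (for n ≥ 1, 0 ≤ k ≤ ⌊n/3⌋, all
-- truncated subtractions below are genuine subtractions)
term : ℕ → ℕ → ℤ
term n k = sgn k ℤ.* (+ ((n C k) ℕ.* ((2 ℕ.* k) C k) ℕ.* ((2 ℕ.* (n ∸ k)) C (n ∸ k))
                        ℕ.* ((((2 ℕ.* n) ∸ (3 ℕ.* k)) ∸ 1) C n ℕ.+ ((2 ℕ.* n) ∸ (3 ℕ.* k)) C n)))

s18 : ℕ → ℤ
s18 zero = + 1
s18 (suc n) = sumTo (suc n / 3) (term (suc n))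

{-# OPTIONS --safe #-}

-- Write n = 3k + l. Since C(2k,k) C(2(n-k),n-k) is C(n,k) times a super Catalan number, the
-- k-th term is a multiple of C(n,k)², so it vanishes modulo p^(2r) when pʳ ∣ n and p ∤ k.
-- The remaining terms at (pn, pk) are compared with those at (n, k): up to sign the term is
-- 3(n-2k)/(2n-3k) · (2k)! (2n-2k)! (2n-3k)! / (k!³ (n-k)!³ l!), so the ratio is the same
-- quotient of factorials with x! replaced by F(x), the product of the integers up to px prime to p.
-- If pˢ divides n and k, put P = p^(s+1). Pairing the residues c and P - c through
-- (Px + c)(Px + P - c) ≡ c(P - c) shows F(pˢx) ≡ wˣ modulo P², with a sign correction only if
-- P = 2, and the powers of w cancel in the ratio. The factor p^(2t) still missing, t = r-1-s,
-- comes from the term at (n, k) itself.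
module Submission where

open import Defs
open import Data.Nat
open import Data.Nat.Properties
open import Data.Nat.DivMod
open import Data.Nat.Divisibility as ℕ using (divides)
open import Data.Nat.Combinatorics using (_C_; nCk≡n!/k![n-k]!; k>n⇒nCk≡0; [n∸k]!k!∣n!)
open import Data.Nat.Primality using (Prime; euclidsLemma; prime⇒nonZero; ¬prime[0]; ¬prime[1]; prime⇒irreducible)
open import Data.Nat.Tactic.RingSolver using (solve-∀)
open import Data.Integer as ℤ using (ℤ; +_; _-_)
open import Data.Integer.Properties as ℤ using (pos-*; pos-+)
open import Data.Integer.Divisibility using (_∣_)
import Data.Integer.Divisibility.Signed as Signed
open import Data.Integer.Tactic.RingSolver using () renaming (solve-∀ to solveℤ-∀)
open import Data.Product using (∃; _×_; _,_)
open import Data.Sum using (_⊎_; inj₁; inj₂; [_,_]′)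
open import Data.Empty using (⊥-elim)
open import Function using (_∘_; it)
open import Relation.Nullary using (¬_; yes; no)
open import Relation.Binary.PropositionalEquality

-- Prime powers and capped valuations.

prime-∤-* : ∀ {p a b} → Prime p → ¬ p ℕ.∣ a → ¬ p ℕ.∣ b → ¬ p ℕ.∣ a * b
prime-∤-* {a = a} {b} pr p∤a p∤b p∣ab with euclidsLemma a b pr p∣ab
... | inj₁ p∣a = p∤a p∣a
... | inj₂ p∣b = p∤b p∣b

prime-power-cancelˡ : ∀ {p} e a b → Prime p → ¬ p ℕ.∣ a → p ^ e ℕ.∣ a * b → p ^ e ℕ.∣ b
prime-power-cancelˡ zero a b pr p∤a _ = ℕ.1∣ b
prime-power-cancelˡ {p} (suc e) a b pr p∤a d
  with euclidsLemma a b pr (ℕ.∣-trans (ℕ.m∣m*n (p ^ e)) d)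
... | inj₁ p∣a = ⊥-elim (p∤a p∣a)
... | inj₂ (divides c refl) =
  subst (p * p ^ e ℕ.∣_) (*-comm p c) (ℕ.*-monoʳ-∣ p (prime-power-cancelˡ e a c pr p∤a
    (ℕ.*-cancelˡ-∣ p {{prime⇒nonZero pr}} (subst (p * p ^ e ℕ.∣_) (shuffle a c p) d))))
  where
  shuffle : ∀ a c p → a * (c * p) ≡ p * (a * c)
  shuffle = solve-∀

-- Writing k = pˢκ with s capped at R makes k = 0 an ordinary case.
capped-valuation : ∀ p R k → ∃ λ s → ∃ λ t → ∃ λ κ →
  s + t ≡ R × k ≡ κ * p ^ s × (t ≡ 0 ⊎ ¬ p ℕ.∣ κ)
capped-valuation p zero k = 0 , 0 , k , refl , sym (*-identityʳ k) , inj₁ refl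
capped-valuation p (suc R) k with p ℕ.∣? k
... | no p∤k = 0 , suc R , k , refl , sym (*-identityʳ k) , inj₂ p∤k
... | yes (divides c refl) with capped-valuation p R c
...   | s , t , κ , refl , refl , h = suc s , t , κ , refl , shuffle κ p (p ^ s) , h
  where
  shuffle : ∀ κ p q → κ * q * p ≡ κ * (p * q)
  shuffle = solve-∀

-- Congruences of integers modulo a natural number.

-- The quotient is kept as data: matching on the equation turns most rules below into ring
-- identities.
record _≈_[mod_] (a b : ℤ) (M : ℕ) : Set where
  constructor modulo
  field
    quotient : ℤ
    equality : a ≡ b ℤ.+ quotient ℤ.* + M

infix 4 _≈_[mod_]

module _ {M : ℕ} where

  ≈-reflexive : ∀ {a b} → a ≡ b → a ≈ b [mod M ]
  ≈-reflexive {a} refl = modulo (+ 0) (eq a (+ M))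
    where
    eq : ∀ a m → a ≡ a ℤ.+ + 0 ℤ.* m
    eq = solveℤ-∀

  ≈-refl : ∀ {a} → a ≈ a [mod M ]
  ≈-refl = ≈-reflexive refl

  ≈-sym : ∀ {a b} → a ≈ b [mod M ] → b ≈ a [mod M ]
  ≈-sym {b = b} (modulo c refl) = modulo (ℤ.- c) (eq b c (+ M))
    where
    eq : ∀ b c m → b ≡ b ℤ.+ c ℤ.* m ℤ.+ ℤ.- c ℤ.* m
    eq = solveℤ-∀

  ≈-trans : ∀ {a b c} → a ≈ b [mod M ] → b ≈ c [mod M ] → a ≈ c [mod M ]
  ≈-trans {c = c} (modulo x refl) (modulo y refl) = modulo (y ℤ.+ x) (eq c x y (+ M))
    where
    eq : ∀ c x y m → c ℤ.+ y ℤ.* m ℤ.+ x ℤ.* m ≡ c ℤ.+ (y ℤ.+ x) ℤ.* m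
    eq = solveℤ-∀

  +-cong-≈ : ∀ {a b c d} → a ≈ b [mod M ] → c ≈ d [mod M ] → a ℤ.+ c ≈ b ℤ.+ d [mod M ]
  +-cong-≈ {b = b} {d = d} (modulo x refl) (modulo y refl) = modulo (x ℤ.+ y) (eq b d x y (+ M))
    where
    eq : ∀ b d x y m → b ℤ.+ x ℤ.* m ℤ.+ (d ℤ.+ y ℤ.* m) ≡ b ℤ.+ d ℤ.+ (x ℤ.+ y) ℤ.* m
    eq = solveℤ-∀

  *-cong-≈ : ∀ {a b c d} → a ≈ b [mod M ] → c ≈ d [mod M ] → a ℤ.* c ≈ b ℤ.* d [mod M ]
  *-cong-≈ {b = b} {d = d} (modulo x refl) (modulo y refl) =
    modulo (b ℤ.* y ℤ.+ x ℤ.* d ℤ.+ x ℤ.* y ℤ.* + M) (eq b d x y (+ M))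
    where
    eq : ∀ b d x y m → (b ℤ.+ x ℤ.* m) ℤ.* (d ℤ.+ y ℤ.* m)
       ≡ b ℤ.* d ℤ.+ (b ℤ.* y ℤ.+ x ℤ.* d ℤ.+ x ℤ.* y ℤ.* m) ℤ.* m
    eq = solveℤ-∀

  *-cong-pos-≈ : ∀ {a b x y} → + a ≈ x [mod M ] → + b ≈ y [mod M ] → + (a * b) ≈ x ℤ.* y [mod M ]
  *-cong-pos-≈ {a} {b} h k = ≈-trans (≈-reflexive (pos-* a b)) (*-cong-≈ h k)

  ∣⇒≈0 : ∀ {a} → M ℕ.∣ a → + a ≈ + 0 [mod M ]
  ∣⇒≈0 (divides q refl) = modulo (+ q) (trans (pos-* q M) (sym (ℤ.+-identityˡ _)))

  ≈⇒∣ : ∀ {a b} → a ≈ b [mod M ] → + M ∣ a - b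
  ≈⇒∣ {b = b} (modulo c refl) =
    divides ℤ.∣ c ∣ (trans (cong ℤ.∣_∣ (eq b c (+ M))) (ℤ.abs-* c (+ M)))
    where
    eq : ∀ b c m → b ℤ.+ c ℤ.* m - b ≡ c ℤ.* m
    eq = solveℤ-∀

  ∣⇒≈ : ∀ {a b} → + M ∣ a - b → a ≈ b [mod M ]
  ∣⇒≈ {a} {b} d with Signed.∣ᵤ⇒∣ {+ M} {a - b} d
  ... | record { quotient = q ; equality = e } = modulo q (trans (eq a b) (cong (λ z → b ℤ.+ z) e))
    where
    eq : ∀ a b → a ≡ b ℤ.+ (a - b)
    eq = solveℤ-∀

  ≈0⇒∣ : ∀ {a} → + a ≈ + 0 [mod M ] → M ℕ.∣ a
  ≈0⇒∣ {a} h = subst (M ℕ.∣_) (cong ℤ.∣_∣ (ℤ.+-identityʳ (+ a))) (≈⇒∣ h)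

-- The difference a - b contributes M and x contributes N. Thus a congruence for the ratio of two
-- terms and the divisibility of a term add up to the full power of p.
≈-*-0 : ∀ {M N a b x} → a ≈ b [mod M ] → x ≈ + 0 [mod N ] → a ℤ.* x ≈ b ℤ.* x [mod M * N ]
≈-*-0 {M} {N} {b = b} (modulo c refl) (modulo d refl) =
  modulo (c ℤ.* d) (trans (eq b c d (+ M) (+ N)) (cong (λ z → b ℤ.* (+ 0 ℤ.+ d ℤ.* + N) ℤ.+ c ℤ.* d ℤ.* z) (sym (pos-* M N))))
  where
  eq : ∀ b c d m n → (b ℤ.+ c ℤ.* m) ℤ.* (+ 0 ℤ.+ d ℤ.* n) ≡ b ℤ.* (+ 0 ℤ.+ d ℤ.* n) ℤ.+ c ℤ.* d ℤ.* (m ℤ.* n)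
  eq = solveℤ-∀

-- Takes the place of inverting a unit modulo p^e, so that ratios never have to be formed.
≈-cancelˡ : ∀ {p} e a {b c} → Prime p → ¬ p ℕ.∣ a →
  + a ℤ.* b ≈ + a ℤ.* c [mod p ^ e ] → b ≈ c [mod p ^ e ]
≈-cancelˡ {p} e a {b} {c} pr p∤a h = ∣⇒≈ (prime-power-cancelˡ e a ℤ.∣ b - c ∣ pr p∤a
  (subst (p ^ e ℕ.∣_) (trans (cong ℤ.∣_∣ (eq (+ a) b c)) (ℤ.abs-* (+ a) (b - c))) (≈⇒∣ h)))
  where
  eq : ∀ a b c → a ℤ.* b - a ℤ.* c ≡ a ℤ.* (b - c)
  eq = solveℤ-∀

-- Finite products and the part of (pa)! prime to p.

prod : ℕ → (ℕ → ℕ) → ℕ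
prod zero f = 1
prod (suc n) f = prod n f * f n

prod-ext : ∀ n {f g} → (∀ i → f i ≡ g i) → prod n f ≡ prod n g
prod-ext zero h = refl
prod-ext (suc n) h = cong₂ _*_ (prod-ext n h) (h n)

prod-+ : ∀ m n f → prod (m + n) f ≡ prod m f * prod n (λ i → f (m + i))
prod-+ m zero f = trans (cong (λ z → prod z f) (+-identityʳ m)) (sym (*-identityʳ _))
prod-+ m (suc n) f = begin
  prod (m + suc n) f                               ≡⟨ cong (λ z → prod z f) (+-suc m n) ⟩
  prod (m + n) f * f (m + n)                       ≡⟨ cong (_* f (m + n)) (prod-+ m n f) ⟩
  prod m f * prod n (λ i → f (m + i)) * f (m + n)  ≡⟨ *-assoc (prod m f) _ _ ⟩
  prod m f * (prod n (λ i → f (m + i)) * f (m + n)) ∎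
  where open ≡-Reasoning

prod-∤ : ∀ {p} → Prime p → ∀ n {f} → (∀ i → i < n → ¬ p ℕ.∣ f i) → ¬ p ℕ.∣ prod n f
prod-∤ {p} pr zero h p∣1 with ℕ.∣1⇒≡1 p∣1
... | refl = ¬prime[1] pr
prod-∤ pr (suc n) h = prime-∤-* pr (prod-∤ pr n (λ i i<n → h i (m<n⇒m<1+n i<n))) (h n ≤-refl)

module _ {M : ℕ} where

  prod-cong-≈ : ∀ n {f g} → (∀ i → + f i ≈ + g i [mod M ]) → + prod n f ≈ + prod n g [mod M ]
  prod-cong-≈ zero h = ≈-refl
  prod-cong-≈ (suc n) h =
    ≈-trans (*-cong-pos-≈ (prod-cong-≈ n h) (h n)) (≈-reflexive (sym (pos-* (prod n _) _)))

  -- The second product is read backwards, so that factor i of the first meets factor n - 1 - i of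
  -- the second; a congruence for each such pair is enough.
  prod-reverse-≈ : ∀ n {f g f′ g′} →
    (∀ i j → suc (i + j) ≡ n → + (f i * g j) ≈ + (f′ i * g′ j) [mod M ]) →
    + (prod n f * prod n g) ≈ + (prod n f′ * prod n g′) [mod M ]
  prod-reverse-≈ zero h = ≈-refl
  prod-reverse-≈ (suc n) {f} {g} {f′} {g′} h =
    -- `peel` takes out the first factor of f and the last of g; what remains is again a pair of
    -- products to be matched in reverse.
    ≈-trans (≈-reflexive (cong +_ (peel f g)))
      (≈-trans (*-cong-pos-≈ (h 0 n refl) (prod-reverse-≈ n λ i j e → h (suc i) j (cong suc e)))
        (≈-trans (≈-reflexive (sym (pos-* (f′ 0 * g′ n) _))) (≈-reflexive (cong +_ (sym (peel f′ g′))))))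
    where
    shuffle : ∀ a b c d → 1 * a * b * (c * d) ≡ a * d * (b * c)
    shuffle = solve-∀
    peel : ∀ f g → prod (suc n) f * prod (suc n) g ≡ f 0 * g n * (prod n (f ∘ suc) * prod n g)
    peel f g = trans (cong (_* prod (suc n) g) (prod-+ 1 n f)) (shuffle (f 0) _ (prod n g) (g n))

-- The prime is suc o, so that the residues 1, …, o need no subtraction.
unitFactorial : ℕ → ℕ → ℕ
unitFactorial o a = prod a λ x → prod o λ i → suc o * x + suc i

!-+ : ∀ n o → (n + o) ! ≡ n ! * prod o (λ i → n + suc i)
!-+ n zero = trans (cong _! (+-identityʳ n)) (sym (*-identityʳ _))
!-+ n (suc o) = begin
  (n + suc o) !                                   ≡⟨ cong _! (+-suc n o) ⟩
  suc (n + o) * (n + o) !                         ≡⟨ cong₂ _*_ (sym (+-suc n o)) (!-+ n o) ⟩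
  (n + suc o) * (n ! * prod o (λ i → n + suc i))  ≡⟨ shuffle (n + suc o) (n !) _ ⟩
  n ! * (prod o (λ i → n + suc i) * (n + suc o))  ∎
  where
  open ≡-Reasoning
  shuffle : ∀ a b c → a * (b * c) ≡ b * (c * a)
  shuffle = solve-∀

-- Among 1, ..., pa the multiples of p give p^a a! and the other integers give `unitFactorial o a`.
[p*a]!≡p^a*a!*unitFactorial : ∀ o a → (suc o * a) ! ≡ suc o ^ a * a ! * unitFactorial o a
[p*a]!≡p^a*a!*unitFactorial o zero rewrite *-zeroʳ o = refl
[p*a]!≡p^a*a!*unitFactorial o (suc a) = begin
  (p * suc a) !                        ≡⟨ cong _! (trans (*-suc p a) (cong suc (+-comm o (p * a)))) ⟩
  suc (p * a + o) * (p * a + o) !      ≡⟨ cong₂ _*_ (expand o a) (!-+ (p * a) o) ⟩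
  p * suc a * ((p * a) ! * B)          ≡⟨ cong (λ z → p * suc a * (z * B)) ([p*a]!≡p^a*a!*unitFactorial o a) ⟩
  p * suc a * (p ^ a * a ! * U * B)    ≡⟨ shuffle p (suc a) (p ^ a) (a !) U B ⟩
  p * p ^ a * (suc a * a !) * (U * B)  ∎
  where
  open ≡-Reasoning
  p = suc o
  U = unitFactorial o a
  B = prod o (λ i → p * a + suc i)
  expand : ∀ o a → suc (suc o * a + o) ≡ suc o * suc a
  expand = solve-∀
  shuffle : ∀ p a q f u b → p * a * (q * f * u * b) ≡ p * q * (a * f) * (u * b)
  shuffle = solve-∀

unitFactorial-∤ : ∀ o → Prime (suc o) → ∀ a → ¬ suc o ℕ.∣ unitFactorial o a
unitFactorial-∤ o pr a = prod-∤ pr a λ x _ → prod-∤ pr o λ i i<o d →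
  ℕ.>⇒∤ (s≤s i<o) (ℕ.∣m+n∣m⇒∣n d (ℕ.m∣m*n x))

-- Blocks of residues prime to p, modulo P².

-- With P = pq this is the product of the integers between Px and P(x + 1) that p does not divide.
-- The offsets from Px are explicit, which lets block x be compared with block 0 factor by factor.
unitBlock : ℕ → ℕ → ℕ → ℕ
unitBlock o q x = prod q λ y → prod o λ i → suc o * q * x + (suc o * y + suc i)

unitFactorial-suc : ∀ o q x → unitFactorial o (suc x * q) ≡ unitFactorial o (x * q) * unitBlock o q x
unitFactorial-suc o q x = begin
  unitFactorial o (q + x * q)  ≡⟨ cong (unitFactorial o) (+-comm q (x * q)) ⟩
  unitFactorial o (x * q + q)  ≡⟨ prod-+ (x * q) q _ ⟩
  _                            ≡⟨ cong (unitFactorial o (x * q) *_)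
                                    (prod-ext q λ y → prod-ext o λ i → expand o q x y i) ⟩
  unitFactorial o (x * q) * unitBlock o q x ∎
  where
  open ≡-Reasoning
  expand : ∀ o q x y i → suc o * (x * q + y) + suc i ≡ suc o * q * x + (suc o * y + suc i)
  expand = solve-∀

unitBlock-∤ : ∀ o q → Prime (suc o) → ∀ x → ¬ suc o ℕ.∣ unitBlock o q x
unitBlock-∤ o q pr x = prod-∤ pr q λ y _ → prod-∤ pr o λ i i<o d →
  ℕ.>⇒∤ (s≤s i<o) (ℕ.∣m+n∣m⇒∣n (ℕ.∣m+n∣m⇒∣n d (ℕ.∣-trans (ℕ.m∣m*n q) (ℕ.m∣m*n x))) (ℕ.m∣m*n y))

-- The cross term Px(c + d) equals P²x, so everything that depends on x is a multiple of P².
opposite-residues : ∀ P x c d → c + d ≡ P →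
  + ((P * x + c) * (P * x + d)) ≈ + ((P * 0 + c) * (P * 0 + d)) [mod P * P ]
opposite-residues _ x c d refl = modulo (+ (x * x + x))
  (trans (cong +_ (expand x c d)) (trans (pos-+ ((P * 0 + c) * (P * 0 + d)) _) (cong (λ z → + ((P * 0 + c) * (P * 0 + d)) ℤ.+ z) (pos-* (x * x + x) (P * P)))))
  where
  P = c + d
  expand : ∀ x c d → ((c + d) * x + c) * ((c + d) * x + d)
    ≡ ((c + d) * 0 + c) * ((c + d) * 0 + d) + (x * x + x) * ((c + d) * (c + d))
  expand = solve-∀

-- The modulus P is enough to show later that the sum of two blocks is prime to an odd p.
unitBlock-const-mod : ∀ o q x → + unitBlock o q x ≈ + unitBlock o q 0 [mod suc o * q ]
unitBlock-const-mod o q x = prod-cong-≈ q λ y → prod-cong-≈ o λ i → shift (suc o * y + suc i)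
  where
  P = suc o * q
  expand : ∀ P x c → P * x + c ≡ P * 0 + c + x * P
  expand = solve-∀
  shift : ∀ c → + (P * x + c) ≈ + (P * 0 + c) [mod P ]
  shift c = modulo (+ x) (trans (cong +_ (expand P x c))
    (trans (pos-+ (P * 0 + c) _) (cong (λ z → + (P * 0 + c) ℤ.+ z) (pos-* x P))))

-- Reversing both indices in the second copy of the block pairs each residue c with P - c. Squaring
-- avoids a choice of one residue from each pair.
unitBlock-square : ∀ o q x → + (unitBlock o q x * unitBlock o q x)
  ≈ + (unitBlock o q 0 * unitBlock o q 0) [mod suc o * q * (suc o * q) ]
unitBlock-square o q x = prod-reverse-≈ q λ y z y+z → prod-reverse-≈ o λ i j i+j →
  opposite-residues P x (suc o * y + suc i) (suc o * z + suc j) (complementary y z i j y+z i+j)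
  where
  P = suc o * q
  expand : ∀ y z i j → suc (suc (i + j)) * y + suc i + (suc (suc (i + j)) * z + suc j)
    ≡ suc (suc (i + j)) * suc (y + z)
  expand = solve-∀
  complementary : ∀ y z i j → suc (y + z) ≡ q → suc (i + j) ≡ o →
    suc o * y + suc i + (suc o * z + suc j) ≡ P
  complementary y z i j refl refl = expand y z i j

odd-prime-∤2 : ∀ {p} → Prime p → p ≢ 2 → ¬ p ℕ.∣ 2
odd-prime-∤2 {0} pr _ _ = ¬prime[0] pr
odd-prime-∤2 {1} pr _ _ = ¬prime[1] pr
odd-prime-∤2 {2} _ p≢2 _ = p≢2 refl
odd-prime-∤2 {suc (suc (suc p))} _ _ d with ℕ.∣⇒≤ d
... | s≤s (s≤s ())

-- Modulo (pq)² both blocks have the same square, and W + w ≡ 2w is prime to p.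
unitBlock-const-odd : ∀ o s x → Prime (suc o) → suc o ≢ 2 →
  + unitBlock o (suc o ^ s) x ≈ + unitBlock o (suc o ^ s) 0 [mod suc o ^ (suc s + suc s) ]
unitBlock-const-odd o s x pr p≢2 = ≈-cancelˡ {p} (suc s + suc s) (W + w) pr p∤W+w
  (subst (λ z → + (W + w) ℤ.* + W ≈ + (W + w) ℤ.* + w [mod z ]) (sym (^-distribˡ-+-* p (suc s) (suc s)))
    (difference (unitBlock-square o q x)))
  where
  p = suc o
  q = p ^ s
  W = unitBlock o q x
  w = unitBlock o q 0
  difference : ∀ {M} → + (W * W) ≈ + (w * w) [mod M ] → + (W + w) ℤ.* + W ≈ + (W + w) ℤ.* + w [mod M ]
  difference h = ≈-trans (≈-reflexive (trans (sym (pos-* (W + w) W)) (trans (cong +_ (*-distribʳ-+ W W w)) (pos-+ (W * W) (w * W)))))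
    (≈-trans (+-cong-≈ h (≈-refl {a = + (w * W)}))
      (≈-reflexive (trans (sym (pos-+ (w * w) (w * W))) (trans (cong +_ (shuffle W w)) (pos-* (W + w) w)))))
    where
    shuffle : ∀ W w → w * w + w * W ≡ (W + w) * w
    shuffle = solve-∀
  double : ∀ w → w + w ≡ 2 * w
  double = solve-∀
  p∤W+w : ¬ p ℕ.∣ W + w
  p∤W+w d = prime-∤-* pr (odd-prime-∤2 pr p≢2) (unitBlock-∤ o q pr 0)
    (≈0⇒∣ (≈-trans (≈-reflexive (trans (cong +_ (sym (double w))) (pos-+ w w)))
      (≈-trans (+-cong-≈ (≈-sym (lower (unitBlock-const-mod o q x))) (≈-refl {a = + w})) (≈-trans (≈-reflexive (sym (pos-+ W w))) (∣⇒≈0 d)))))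
    where
    lower : ∀ {a b} → a ≈ b [mod p * q ] → a ≈ b [mod p ]
    lower {b = b} (modulo c refl) = modulo (c ℤ.* + q)
      (cong (λ z → b ℤ.+ z) (trans (cong (c ℤ.*_) (pos-* p q)) (shuffle c (+ p) (+ q))))
      where
      shuffle : ∀ c p q → c ℤ.* (p ℤ.* q) ≡ c ℤ.* q ℤ.* p
      shuffle = solveℤ-∀

-- For p = 2 the sum of two blocks is even and cannot be cancelled. But 4 divides P here, so an odd
-- c differs from P - c, and reversing the upper half of the block against the lower half pairs them
-- without squaring.
unitBlock-const-4∣ : ∀ s x →
  + unitBlock 1 (2 ^ suc s) x ≈ + unitBlock 1 (2 ^ suc s) 0 [mod 2 ^ (suc (suc s) + suc (suc s)) ]
unitBlock-const-4∣ s x = subst₂ (λ a b → + a ≈ + b [mod 2 ^ (suc (suc s) + suc (suc s)) ]) (sym (split x)) (sym (split 0))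
  (subst (λ z → + (lower x * upper x) ≈ + (lower 0 * upper 0) [mod z ])
    (sym (^-distribˡ-+-* 2 (suc (suc s)) (suc (suc s))))
    (prod-reverse-≈ h λ i j i+j → subst₂ (λ a b → + a ≈ + b [mod P * P ]) (unit x i j) (unit 0 i j)
      (opposite-residues P x (2 * i + 1) (2 * (h + j) + 1) (complementary i j i+j))))
  where
  P = 2 ^ suc (suc s)
  h = 2 ^ s
  factor : ℕ → ℕ → ℕ
  factor x y = prod 1 λ i → P * x + (2 * y + suc i)
  lower upper : ℕ → ℕ
  lower x = prod h (factor x)
  upper x = prod h (λ y → factor x (h + y))
  split : ∀ x → unitBlock 1 (2 ^ suc s) x ≡ lower x * upper x
  split x = trans (cong (λ z → prod z (factor x)) (cong (λ z → h + z) (+-identityʳ h))) (prod-+ h h (factor x))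
  unit : ∀ x i j → (P * x + (2 * i + 1)) * (P * x + (2 * (h + j) + 1)) ≡ factor x i * factor x (h + j)
  unit x i j = sym (cong₂ _*_ (*-identityˡ (P * x + (2 * i + 1))) (*-identityˡ (P * x + (2 * (h + j) + 1))))
  expand : ∀ i j h → 2 * i + 1 + (2 * (h + j) + 1) ≡ 2 * suc (i + j) + 2 * h
  expand = solve-∀
  expand₂ : ∀ h → 2 * h + 2 * h ≡ 2 * (2 * h)
  expand₂ = solve-∀
  complementary : ∀ i j → suc (i + j) ≡ h → 2 * i + 1 + (2 * (h + j) + 1) ≡ P
  complementary i j e = trans (expand i j h) (trans (cong (λ z → 2 * z + 2 * h) e) (expand₂ h))

-- Block x is the single number 2x + 1, and consecutive odd numbers add up to a multiple of 4.
unitBlock-mod-4 : ∀ x → + unitBlock 1 1 x ≈ (ℤ.- + 1) ℤ.^ x [mod 4 ]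
unitBlock-mod-4 zero = ≈-refl
unitBlock-mod-4 (suc x) = ≈-trans (step x) (*-cong-≈ {a = ℤ.- + 1} {b = ℤ.- + 1} {c = + unitBlock 1 1 x} {d = (ℤ.- + 1) ℤ.^ x} ≈-refl (unitBlock-mod-4 x))
  where
  expand : ∀ x → + 1 ℤ.* (+ 1 ℤ.* (+ 2 ℤ.* (+ 1 ℤ.+ x) ℤ.+ + 1))
    ≡ ℤ.- + 1 ℤ.* (+ 1 ℤ.* (+ 1 ℤ.* (+ 2 ℤ.* x ℤ.+ + 1))) ℤ.+ (x ℤ.+ + 1) ℤ.* + 4
  expand = solveℤ-∀
  cast : ∀ x → + unitBlock 1 1 x ≡ + 1 ℤ.* (+ 1 ℤ.* (+ 2 ℤ.* + x ℤ.+ + 1))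
  cast x = trans (pos-* 1 _) (cong (+ 1 ℤ.*_) (trans (pos-* 1 _) (cong (+ 1 ℤ.*_)
    (trans (pos-+ (2 * x) 1) (cong (ℤ._+ + 1) (pos-* 2 x))))))
  step : ∀ x → + unitBlock 1 1 (suc x) ≈ ℤ.- + 1 ℤ.* + unitBlock 1 1 x [mod 4 ]
  step x = modulo (+ x ℤ.+ + 1) (trans (cast (suc x)) (trans (expand (+ x))
    (cong (λ z → ℤ.- + 1 ℤ.* z ℤ.+ (+ x ℤ.+ + 1) ℤ.* + 4) (sym (cast x)))))

-- Signs.

sgn-+ : ∀ m n → sgn (m + n) ≡ sgn m ℤ.* sgn n
sgn-+ zero n = sym (ℤ.*-identityˡ (sgn n))
sgn-+ (suc m) n = trans (cong ℤ.-_ (sgn-+ m n)) (ℤ.neg-distribˡ-* (sgn m) (sgn n))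

sgn-square : ∀ n → sgn n ℤ.* sgn n ≡ + 1
sgn-square zero = refl
sgn-square (suc n) = trans (neg*neg (sgn n)) (sgn-square n)
  where
  neg*neg : ∀ a → ℤ.- a ℤ.* ℤ.- a ≡ a ℤ.* a
  neg*neg = solveℤ-∀

sgn-double : ∀ n → sgn (2 * n) ≡ + 1
sgn-double n = trans (cong sgn (cong (λ z → n + z) (+-identityʳ n))) (trans (sgn-+ n n) (sgn-square n))

-1^n≡sgn : ∀ n → (ℤ.- + 1) ℤ.^ n ≡ sgn n
-1^n≡sgn zero = refl
-1^n≡sgn (suc n) = trans (cong (ℤ.- + 1 ℤ.*_) (-1^n≡sgn n)) (ℤ.-1*i≡-i (sgn n))

even⊎odd : ∀ n → ∃ λ h → n ≡ 2 * h ⊎ n ≡ 1 + 2 * h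
even⊎odd zero = 0 , inj₁ refl
even⊎odd (suc n) with even⊎odd n
... | h , inj₁ refl = h , inj₂ refl
... | h , inj₂ refl = suc h , inj₁ (expand h)
  where
  expand : ∀ h → 2 + 2 * h ≡ 2 * suc h
  expand = solve-∀

sgn-odd-prime : ∀ p k → Prime p → p ≢ 2 → sgn (p * k) ≡ sgn k
sgn-odd-prime p k pr p≢2 with even⊎odd p
... | h , inj₂ refl = begin
  sgn ((1 + 2 * h) * k)        ≡⟨ cong sgn (expand h k) ⟩
  sgn (k + 2 * (h * k))        ≡⟨ sgn-+ k (2 * (h * k)) ⟩
  sgn k ℤ.* sgn (2 * (h * k))  ≡⟨ cong (sgn k ℤ.*_) (sgn-double (h * k)) ⟩
  sgn k ℤ.* + 1                ≡⟨ ℤ.*-identityʳ (sgn k) ⟩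
  sgn k                        ∎
  where
  open ≡-Reasoning
  expand : ∀ h k → (1 + 2 * h) * k ≡ k + 2 * (h * k)
  expand = solve-∀
... | h , inj₁ refl with prime⇒irreducible pr (ℕ.m∣m*n h)
...   | inj₂ 2≡p = ⊥-elim (p≢2 (sym 2≡p))

-- Treats odd p, p = 2 with 4 ∣ P, and P = 2 uniformly: block x is congruent to block 0 times εˣ. By
-- `sgn-scale`, ε^κ also accounts for the change from the sign of k to that of pk.
record BlockSign (o s : ℕ) : Set where
  field
    ε : ℤ
    ε²≡1 : ε ℤ.* ε ≡ + 1
    unitBlock≈ : ∀ x → + unitBlock o (suc o ^ s) x
      ≈ + unitBlock o (suc o ^ s) 0 ℤ.* ε ℤ.^ x [mod suc o ^ (suc s + suc s) ]
    sgn-scale : ∀ κ → sgn (κ * suc o ^ s) ℤ.* ε ℤ.^ κ ≡ sgn (suc o * (κ * suc o ^ s))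

*1^ : ∀ a n → a ≡ a ℤ.* (+ 1) ℤ.^ n
*1^ a n = sym (trans (cong (a ℤ.*_) (ℤ.^-zeroˡ n)) (ℤ.*-identityʳ a))

-- The sign is nontrivial only modulo 4: there the block is 2x + 1 ≡ (-1)ˣ.
blockSign : ∀ o s → Prime (suc o) → BlockSign o s
blockSign o s pr with suc o ≟ 2
... | no p≢2 = record
  { ε = + 1
  ; ε²≡1 = refl
  ; unitBlock≈ = λ x → ≈-trans (unitBlock-const-odd o s x pr p≢2) (≈-reflexive (*1^ _ x))
  ; sgn-scale = λ κ → trans (sym (*1^ _ κ)) (sym (sgn-odd-prime (suc o) (κ * suc o ^ s) pr p≢2))
  }
blockSign .1 zero pr | yes refl = record
  { ε = ℤ.- + 1
  ; ε²≡1 = refl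
  ; unitBlock≈ = λ x → ≈-trans (unitBlock-mod-4 x) (≈-reflexive (sym (ℤ.*-identityˡ _)))
  -- The sign of 2κ is +1, and (-1)^κ cancels the sign of κ.
  ; sgn-scale = λ κ → trans
      (cong₂ ℤ._*_ (cong sgn (*-identityʳ κ)) (-1^n≡sgn κ))
      (trans (sgn-square κ) (sym (sgn-double (κ * 1))))
  }
blockSign .1 (suc s) pr | yes refl = record
  { ε = + 1
  ; ε²≡1 = refl
  ; unitBlock≈ = λ x → ≈-trans (unitBlock-const-4∣ s x) (≈-reflexive (*1^ _ x))
  ; sgn-scale = λ κ → trans (sym (*1^ _ κ))
      (trans (cong sgn (shuffle κ (2 ^ s)))
        (trans (sgn-double (κ * 2 ^ s)) (sym (sgn-double (κ * 2 ^ suc s)))))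
  }
  where
  shuffle : ∀ κ q → κ * (2 * q) ≡ 2 * (κ * q)
  shuffle = solve-∀

-- With n = 3k + l, the summand is, up to sign,
-- 3(n - 2k)/(2n - 3k) · numerator _! k l / denominator _! k l.
numerator denominator : (ℕ → ℕ) → ℕ → ℕ → ℕ
numerator φ k l = φ (2 * k) * φ (2 * (2 * k + l)) * φ (3 * k + 2 * l)
denominator φ k l = φ k * φ k * φ k * (φ (2 * k + l) * φ (2 * k + l) * φ (2 * k + l)) * φ l

-- Triangular numbers.

-- This is x(x - 1)/2, the exponent of ε collected by the blocks 0, ..., x - 1.
triangle : ℕ → ℕ
triangle zero = 0
triangle (suc x) = triangle x + x

triangle-+ : ∀ x y → triangle (x + y) ≡ triangle x + triangle y + x * y
triangle-+ zero y = sym (+-identityʳ _)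
triangle-+ (suc x) y = trans (cong (_+ (x + y)) (triangle-+ x y)) (shuffle x y (triangle x) (triangle y))
  where
  shuffle : ∀ x y a b → a + b + x * y + (x + y) ≡ a + x + b + (y + x * y)
  shuffle = solve-∀

triangle-double : ∀ x → triangle (2 * x) ≡ 2 * triangle x + x * x
triangle-double x = trans (cong triangle (cong (λ z → x + z) (+-identityʳ x)))
  (trans (triangle-+ x x) (shuffle (triangle x) x))
  where
  shuffle : ∀ a x → a + a + x * x ≡ 2 * a + x * x
  shuffle = solve-∀

x²≡x+2*triangle : ∀ x → x * x ≡ x + 2 * triangle x
x²≡x+2*triangle zero = refl
x²≡x+2*triangle (suc x) = trans (expand x) (trans (cong (λ z → z + 2 * x + 1) (x²≡x+2*triangle x)) (shuffle x (triangle x)))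
  where
  expand : ∀ x → suc x * suc x ≡ x * x + 2 * x + 1
  expand = solve-∀
  shuffle : ∀ x t → x + 2 * t + 2 * x + 1 ≡ suc x + 2 * (t + x)
  shuffle = solve-∀

-- The factorial quotient modulo p^(2s+2).

module _ {o s : ℕ} (sign : BlockSign o s) where

  open BlockSign sign

  private
    q M : ℕ
    q = suc o ^ s
    M = suc o ^ (suc s + suc s)
    w : ℤ
    w = + unitBlock o q 0
    g : ℕ → ℕ → ℤ
    g a b = w ℤ.^ a ℤ.* ε ℤ.^ b

    g-* : ∀ a b c d → g a b ℤ.* g c d ≡ g (a + c) (b + d)
    g-* a b c d = trans (shuffle (w ℤ.^ a) (ε ℤ.^ b) (w ℤ.^ c) (ε ℤ.^ d))
      (sym (cong₂ ℤ._*_ (ℤ.^-distribˡ-+-* w a c) (ℤ.^-distribˡ-+-* ε b d)))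
      where
      shuffle : ∀ a b c d → a ℤ.* b ℤ.* (c ℤ.* d) ≡ a ℤ.* c ℤ.* (b ℤ.* d)
      shuffle = solveℤ-∀

    ε^even : ∀ n → ε ℤ.^ (2 * n) ≡ + 1
    ε^even n = trans (sym (ℤ.^-*-assoc ε 2 n))
      (trans (cong (ℤ._^ n) (trans (cong (ε ℤ.*_) (ℤ.*-identityʳ ε)) ε²≡1)) (ℤ.^-zeroˡ n))

    -- The exponents are indices of the type, so that `_⊗_` collects those of a long product.
    record Monomial (a i j : ℕ) : Set where
      constructor monomial
      field
        value : + a ≈ g i j [mod M ]

    open Monomial

    infixl 7 _⊗_
    _⊗_ : ∀ {a b i j k l} → Monomial a i j → Monomial b k l → Monomial (a * b) (i + k) (j + l)
    value (_⊗_ {i = i} {j} {k} {l} h h′) = ≈-trans (*-cong-pos-≈ (value h) (value h′)) (≈-reflexive (g-* i j k l))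

  -- The product splits into the blocks 0, ..., x - 1, and block i contributes w εⁱ.
  unitFactorial≈ : ∀ x → + unitFactorial o (x * q) ≈ w ℤ.^ x ℤ.* ε ℤ.^ triangle x [mod M ]
  unitFactorial≈ zero = ≈-refl
  unitFactorial≈ (suc x) = ≈-trans (≈-reflexive (cong +_ (unitFactorial-suc o q x)))
    (≈-trans (*-cong-pos-≈ {x = g x (triangle x)} {y = w ℤ.* ε ℤ.^ x} (unitFactorial≈ x) (unitBlock≈ x))
      (≈-reflexive (trans (shuffle (w ℤ.^ x) (ε ℤ.^ triangle x) w (ε ℤ.^ x))
        (cong (w ℤ.^ suc x ℤ.*_) (sym (ℤ.^-distribˡ-+-* ε (triangle x) x))))))
    where
    shuffle : ∀ a b c d → a ℤ.* b ℤ.* (c ℤ.* d) ≡ c ℤ.* a ℤ.* (b ℤ.* d)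
    shuffle = solveℤ-∀

  -- Both sides have degree 9κ + 4λ′ in w. The exponents of ε matter only modulo 2, and the
  -- triangular sums of the two sides differ by κ up to an even number, which the factor ε^κ
  -- corrects.
  numerator≈denominator : ∀ κ λ′ →
    + numerator (λ x → unitFactorial o (x * q)) κ λ′ ℤ.* ε ℤ.^ κ
      ≈ + denominator (λ x → unitFactorial o (x * q)) κ λ′ [mod M ]
  numerator≈denominator κ l = ≈-trans (*-cong-≈ (value (G (2 * κ) ⊗ G (2 * m) ⊗ G (3 * κ + 2 * l))) (≈-refl {a = ε ℤ.^ κ}))
    (≈-trans (≈-reflexive balance)
      (≈-sym (value (G κ ⊗ G κ ⊗ G κ ⊗ (G m ⊗ G m ⊗ G m) ⊗ G l))))
    where
    G : ∀ x → Monomial (unitFactorial o (x * q)) x (triangle x)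
    G x = monomial (unitFactorial≈ x)
    T = triangle
    m = 2 * κ + l
    a₁ = 2 * κ + 2 * m + (3 * κ + 2 * l)
    b₁ = T (2 * κ) + T (2 * m) + T (3 * κ + 2 * l)
    a₂ = κ + κ + κ + (m + m + m) + l
    b₂ = T κ + T κ + T κ + (T m + T m + T m) + T l
    -- `κ + e` is half of b₁ + κ - b₂. That difference contains 7κ²; one κ² is rewritten as κ + 2 T
    -- κ to make it visibly even.
    e = 3 * (κ * κ) + T κ + 4 * (κ * l) + l * l
    degrees : ∀ κ l → 2 * κ + 2 * (2 * κ + l) + (3 * κ + 2 * l) ≡ κ + κ + κ + (2 * κ + l + (2 * κ + l) + (2 * κ + l)) + l
    degrees = solve-∀
    -- Splitting off m leaves κ + l, so that only T m, T κ and T l arise, as in the denominator.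
    split : ∀ κ l → 3 * κ + 2 * l ≡ 2 * κ + l + (κ + l)
    split = solve-∀
    collect : ∀ κ l t u v → 2 * t + κ * κ + (2 * u + (2 * κ + l) * (2 * κ + l)) + (u + (t + v + κ * l) + (2 * κ + l) * (κ + l)) + κ
      ≡ t + t + t + (u + u + u) + v + (6 * (κ * κ) + κ * κ + κ + 8 * (κ * l) + 2 * (l * l))
    collect = solve-∀
    even : ∀ κ l t → 6 * (κ * κ) + (κ + 2 * t) + κ + 8 * (κ * l) + 2 * (l * l) ≡ 2 * (κ + (3 * (κ * κ) + t + 4 * (κ * l) + l * l))
    even = solve-∀
    sameParity : b₁ + κ ≡ b₂ + 2 * (κ + e)
    sameParity = begin
      T (2 * κ) + T (2 * m) + T (3 * κ + 2 * l) + κ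
        ≡⟨ cong (_+ κ) (cong₂ _+_ (cong₂ _+_ (triangle-double κ) (triangle-double m))
             (trans (cong T (split κ l)) (trans (triangle-+ m (κ + l)) (cong (λ z → T m + z + m * (κ + l)) (triangle-+ κ l))))) ⟩
      _ ≡⟨ collect κ l (T κ) (T m) (T l) ⟩
      b₂ + (6 * (κ * κ) + κ * κ + κ + 8 * (κ * l) + 2 * (l * l))
        ≡⟨ cong (λ z → b₂ + (6 * (κ * κ) + z + κ + 8 * (κ * l) + 2 * (l * l))) (x²≡x+2*triangle κ) ⟩
      _ ≡⟨ cong (λ z → b₂ + z) (even κ l (T κ)) ⟩
      b₂ + 2 * (κ + e) ∎
      where open ≡-Reasoning
    balance : g a₁ b₁ ℤ.* ε ℤ.^ κ ≡ g a₂ b₂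
    balance = begin
      w ℤ.^ a₁ ℤ.* ε ℤ.^ b₁ ℤ.* ε ℤ.^ κ       ≡⟨ ℤ.*-assoc (w ℤ.^ a₁) _ _ ⟩
      w ℤ.^ a₁ ℤ.* (ε ℤ.^ b₁ ℤ.* ε ℤ.^ κ)     ≡⟨ cong (w ℤ.^ a₁ ℤ.*_) (sym (ℤ.^-distribˡ-+-* ε b₁ κ)) ⟩
      w ℤ.^ a₁ ℤ.* ε ℤ.^ (b₁ + κ)             ≡⟨ cong₂ (λ a b → w ℤ.^ a ℤ.* ε ℤ.^ b) (degrees κ l) sameParity ⟩
      w ℤ.^ a₂ ℤ.* ε ℤ.^ (b₂ + 2 * (κ + e))   ≡⟨ cong (w ℤ.^ a₂ ℤ.*_) (ℤ.^-distribˡ-+-* ε b₂ (2 * (κ + e))) ⟩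
      w ℤ.^ a₂ ℤ.* (ε ℤ.^ b₂ ℤ.* ε ℤ.^ (2 * (κ + e)))
        ≡⟨ cong (λ z → w ℤ.^ a₂ ℤ.* (ε ℤ.^ b₂ ℤ.* z)) (ε^even (κ + e)) ⟩
      w ℤ.^ a₂ ℤ.* (ε ℤ.^ b₂ ℤ.* + 1)         ≡⟨ cong (w ℤ.^ a₂ ℤ.*_) (ℤ.*-identityʳ _) ⟩
      g a₂ b₂ ∎
      where open ≡-Reasoning

-- Binomial coefficients and super Catalan numbers.

C-! : ∀ a b → ((a + b) C a) * (a ! * b !) ≡ (a + b) !
C-! a b = begin
  ((a + b) C a) * (a ! * b !)                     ≡⟨ cong (λ z → ((a + b) C a) * (a ! * z !)) (sym (m+n∸m≡n a b)) ⟩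
  ((a + b) C a) * (a ! * (a + b ∸ a) !)           ≡⟨ cong (_* (a ! * (a + b ∸ a) !)) (nCk≡n!/k![n-k]! (m≤m+n a b)) ⟩
  (a + b) ! / (a ! * (a + b ∸ a) !) * (a ! * (a + b ∸ a) !)
    ≡⟨ m/n*n≡m (subst (ℕ._∣ (a + b) !) (*-comm ((a + b ∸ a) !) (a !)) ([n∸k]!k!∣n! (m≤m+n a b))) ⟩
  (a + b) !                                       ∎
  where
  open ≡-Reasoning
  instance _ = a !* (a + b ∸ a) !≢0

-- With N = `suc z` this expresses C(N - 1, n) through C(N, n), which merges the two binomials of
-- the bracket. For l = 0 both sides are 0.
C-lower-suc : ∀ n l z → suc z ≡ n + l → suc z * (z C n) ≡ l * (suc z C n)
C-lower-suc n zero z e = trans (cong (suc z *_) (k>n⇒nCk≡0 (≤-reflexive (trans e (+-identityʳ n))))) (*-zeroʳ (suc z))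
C-lower-suc n (suc l) z e with suc-injective (trans e (+-suc n l))
... | refl = *-cancelʳ-≡ _ _ (n ! * l !) (begin
  suc z * (z C n) * (n ! * l !)          ≡⟨ *-assoc (suc z) (z C n) (n ! * l !) ⟩
  suc z * ((z C n) * (n ! * l !))        ≡⟨ cong (suc z *_) (C-! n l) ⟩
  suc (n + l) * (n + l) !                ≡⟨ cong _! (sym (+-suc n l)) ⟩
  (n + suc l) !                          ≡⟨ sym (C-! n (suc l)) ⟩
  ((n + suc l) C n) * (n ! * suc l !)    ≡⟨ cong (λ y → (y C n) * (n ! * suc l !)) (+-suc n l) ⟩
  (suc z C n) * (n ! * (suc l * l !))    ≡⟨ shuffle (suc z C n) (n !) (suc l) (l !) ⟩
  suc l * (suc z C n) * (n ! * l !)      ∎)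
  where
  open ≡-Reasoning
  instance _ = n !* l !≢0
  shuffle : ∀ c f l g → c * (f * (l * g)) ≡ l * c * (f * g)
  shuffle = solve-∀

-- For 1 ≤ k ≤ n the quotient is C(n - 1, k - 1). Powers of p that n has beyond those of k therefore
-- pass to C(n, k).
n∣k*nCk : ∀ n k → n ℕ.∣ k * (n C k)
n∣k*nCk n zero = n ℕ.∣0
n∣k*nCk n (suc k) with suc k ≤? n
... | no k≰n = subst (λ z → n ℕ.∣ suc k * z) (sym (k>n⇒nCk≡0 (≰⇒> k≰n))) (subst (n ℕ.∣_) (sym (*-zeroʳ (suc k))) (n ℕ.∣0))
... | yes k≤n with m≤n⇒∃[o]m+o≡n k≤n
...   | m , refl = divides ((k + m) C k) (*-cancelʳ-≡ _ _ (k ! * m !) (begin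
  suc k * X * (k ! * m !)               ≡⟨ shuffle (suc k) X (k !) (m !) ⟩
  X * (suc k * k ! * m !)               ≡⟨ C-! (suc k) m ⟩
  suc (k + m) * (k + m) !               ≡⟨ cong (suc (k + m) *_) (sym (C-! k m)) ⟩
  suc (k + m) * (((k + m) C k) * (k ! * m !))  ≡⟨ shuffle′ (suc (k + m)) ((k + m) C k) _ ⟩
  ((k + m) C k) * suc (k + m) * (k ! * m !)    ∎))
  where
  open ≡-Reasoning
  X = suc (k + m) C suc k
  instance _ = k !* m !≢0
  shuffle : ∀ k x f g → k * x * (f * g) ≡ x * (k * f * g)
  shuffle = solve-∀
  shuffle′ : ∀ a b c → a * (b * c) ≡ b * a * c
  shuffle′ = solve-∀

-- The super Catalan numbers (2a)!(2b)!/(a! b! (a+b)!): this recursion shows that they are integers.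
superCatalan : ℕ → ℕ → ℤ
superCatalan a zero = + ((2 * a) C a)
superCatalan a (suc b) = + 4 ℤ.* superCatalan a b - superCatalan (suc a) b

centralC-! : ∀ a → ((2 * a) C a) * (a ! * a !) ≡ (2 * a) !
centralC-! a = trans (cong (λ z → (z C a) * (a ! * a !)) 2a≡a+a) (trans (C-! a a) (cong _! (sym 2a≡a+a)))
  where
  2a≡a+a : 2 * a ≡ a + a
  2a≡a+a = cong (λ z → a + z) (+-identityʳ a)

[2*suc]! : ∀ a → (2 * suc a) ! ≡ (2 * a + 2) * (2 * a + 1) * (2 * a) !
[2*suc]! a = trans (cong _! (expand a)) (shuffle (2 * a) ((2 * a) !))
  where
  expand : ∀ a → 2 * suc a ≡ suc (suc (2 * a))
  expand = solve-∀
  shuffle : ∀ b f → suc (suc b) * (suc b * f) ≡ (b + 2) * (b + 1) * f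
  shuffle = solve-∀

-- Induction on b: the factorial quotient obeys the defining recursion because 4(a + b + 1) = 2(2b +
-- 1) + 2(2a + 1).
superCatalan-! : ∀ a b → superCatalan a b ℤ.* + (a ! * b ! * (a + b) !) ≡ + ((2 * a) ! * (2 * b) !)
superCatalan-! a zero = trans (sym (pos-* ((2 * a) C a) _)) (cong +_ (begin
  ((2 * a) C a) * (a ! * 1 * (a + 0) !) ≡⟨ cong (((2 * a) C a) *_) (cong₂ _*_ (*-identityʳ (a !)) (cong _! (+-identityʳ a))) ⟩
  ((2 * a) C a) * (a ! * a !)           ≡⟨ centralC-! a ⟩
  (2 * a) !                             ≡⟨ sym (*-identityʳ _) ⟩
  (2 * a) ! * 1                         ∎))
  where open ≡-Reasoning
superCatalan-! a (suc b) = begin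
  (+ 4 ℤ.* s - t) ℤ.* + (a ! * suc b ! * (a + suc b) !)
    ≡⟨ cong (λ z → (+ 4 ℤ.* s - t) ℤ.* + z) (trans (cong (λ z → a ! * suc b ! * z !) (+-suc a b))
         (arrange (a !) (suc b) (b !) n ((a + b) !))) ⟩
  (+ 4 ℤ.* s - t) ℤ.* + (suc b * (n * y))
    ≡⟨ cong ((+ 4 ℤ.* s - t) ℤ.*_) (trans (pos-* (suc b) (n * y)) (cong (+ suc b ℤ.*_) (pos-* n y))) ⟩
  (+ 4 ℤ.* s - t) ℤ.* (+ suc b ℤ.* (+ n ℤ.* + y))
    ≡⟨ expand s t (+ suc b) (+ n) (+ y) ⟩
  + 4 ℤ.* (+ suc b ℤ.* (+ n ℤ.* (s ℤ.* + y))) - + suc b ℤ.* (t ℤ.* (+ n ℤ.* + y))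
    ≡⟨ cong₂ (λ u v → + 4 ℤ.* (+ suc b ℤ.* (+ n ℤ.* u)) - + suc b ℤ.* v) (superCatalan-! a b)
         (trans (cong (t ℤ.*_) (sym (pos-* n y))) reduced) ⟩
  + 4 ℤ.* (+ suc b ℤ.* (+ n ℤ.* + U)) - + suc b ℤ.* + V
    ≡⟨ cong₂ (λ u v → + 4 ℤ.* u - v) (trans (cong (+ suc b ℤ.*_) (sym (pos-* n U))) (sym (pos-* (suc b) (n * U)))) (sym (pos-* (suc b) V)) ⟩
  + 4 ℤ.* + (suc b * (n * U)) - + (suc b * V)
    ≡⟨ cong (_- + (suc b * V)) (sym (pos-* 4 (suc b * (n * U)))) ⟩
  + (4 * (suc b * (n * U))) - + (suc b * V)
    ≡⟨ cong (λ z → + z - + (suc b * V)) (split a b ((2 * a) !) ((2 * b) !)) ⟩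
  + (R + suc b * V) - + (suc b * V)
    ≡⟨ cong (_- + (suc b * V)) (pos-+ R (suc b * V)) ⟩
  + R ℤ.+ + (suc b * V) - + (suc b * V)
    ≡⟨ drop (+ R) (+ (suc b * V)) ⟩
  + R
    ≡⟨ cong (λ z → + ((2 * a) ! * z)) (sym ([2*suc]! b)) ⟩
  + ((2 * a) ! * (2 * suc b) !) ∎
  where
  s = superCatalan a b
  t = superCatalan (suc a) b
  n = suc (a + b)
  y = a ! * b ! * (a + b) !
  U = (2 * a) ! * (2 * b) !
  V = 2 * (2 * a + 1) * U
  R = (2 * a) ! * ((2 * b + 2) * (2 * b + 1) * (2 * b) !)
  arrange : ∀ α x β y γ → α * (x * β) * (y * γ) ≡ x * (y * (α * β * γ))
  arrange = solve-∀
  arrange′ : ∀ α x β y γ → x * α * β * (y * γ) ≡ x * (y * (α * β * γ))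
  arrange′ = solve-∀
  arrange″ : ∀ a A B → (2 * a + 2) * (2 * a + 1) * A * B ≡ suc a * (2 * (2 * a + 1) * (A * B))
  arrange″ = solve-∀
  expand : ∀ s t c n y → (+ 4 ℤ.* s - t) ℤ.* (c ℤ.* (n ℤ.* y))
    ≡ + 4 ℤ.* (c ℤ.* (n ℤ.* (s ℤ.* y))) - c ℤ.* (t ℤ.* (n ℤ.* y))
  expand = solveℤ-∀
  split : ∀ a b A B → 4 * (suc b * (suc (a + b) * (A * B)))
    ≡ A * ((2 * b + 2) * (2 * b + 1) * B) + suc b * (2 * (2 * a + 1) * (A * B))
  split = solve-∀
  drop : ∀ r v → r ℤ.+ v - v ≡ r
  drop = solveℤ-∀
  open ≡-Reasoning
  -- The induction hypothesis at `suc a` has the factor `suc a` on both sides; removing it leaves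
  -- the factorials of the hypothesis at a.
  reduced : t ℤ.* + (n * y) ≡ + V
  reduced = ℤ.*-cancelˡ-≡ (+ suc a) _ _ (begin
    + suc a ℤ.* (t ℤ.* + (n * y))           ≡⟨ swap (+ suc a) t (+ (n * y)) ⟩
    t ℤ.* (+ suc a ℤ.* + (n * y))           ≡⟨ cong (t ℤ.*_) (trans (sym (pos-* (suc a) (n * y))) (cong +_ (sym (arrange′ (a !) (suc a) (b !) (suc (a + b)) ((a + b) !))))) ⟩
    t ℤ.* + (suc a ! * b ! * (suc a + b) !)  ≡⟨ superCatalan-! (suc a) b ⟩
    + ((2 * suc a) ! * (2 * b) !)     ≡⟨ cong +_ (trans (cong (_* (2 * b) !) ([2*suc]! a)) (arrange″ a ((2 * a) !) ((2 * b) !))) ⟩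
    + (suc a * V)                     ≡⟨ pos-* (suc a) V ⟩
    + suc a ℤ.* + V                   ∎)
    where
    swap : ∀ a t y → a ℤ.* (t ℤ.* y) ≡ t ℤ.* (a ℤ.* y)
    swap = solveℤ-∀

-- With a = k and b = n - k this takes a second C(n, k) out of the central binomials of the summand.
-- Both sides agree after multiplication by (a! b!)².
centralC-product : ∀ a b → superCatalan a b ℤ.* + ((a + b) C a) ≡ + (((2 * a) C a) * ((2 * b) C b))
centralC-product a b = ℤ.*-cancelʳ-≡ _ _ (+ Z) (begin
  S ℤ.* + X ℤ.* + Z                        ≡⟨ ℤ.*-assoc S (+ X) (+ Z) ⟩
  S ℤ.* (+ X ℤ.* + Z)                      ≡⟨ cong (S ℤ.*_) (sym (pos-* X Z)) ⟩
  S ℤ.* + (X * Z)                          ≡⟨ cong (λ z → S ℤ.* + z) (trans (arrange X (a !) (b !)) (cong (a ! * b ! *_) (C-! a b))) ⟩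
  S ℤ.* + (a ! * b ! * (a + b) !)          ≡⟨ superCatalan-! a b ⟩
  + ((2 * a) ! * (2 * b) !)                ≡⟨ cong +_ (sym (cong₂ _*_ (centralC-! a) (centralC-! b))) ⟩
  + (A * (a ! * a !) * (B * (b ! * b !)))  ≡⟨ cong +_ (arrange′ A B (a !) (b !)) ⟩
  + (A * B * Z)                            ≡⟨ pos-* (A * B) Z ⟩
  + (A * B) ℤ.* + Z                        ∎)
  where
  open ≡-Reasoning
  S = superCatalan a b
  X = (a + b) C a
  A = (2 * a) C a
  B = (2 * b) C b
  Z = a ! * b ! * (a ! * b !)
  instance
    _ = a !* b !≢0
    _ = m*n≢0 (a ! * b !) (a ! * b !)
  arrange : ∀ x f g → x * (f * g * (f * g)) ≡ f * g * (x * (f * g))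
  arrange = solve-∀
  arrange′ : ∀ A B f g → A * (f * f) * (B * (g * g)) ≡ A * B * (f * g * (f * g))
  arrange′ = solve-∀

-- The summand: divisibility and closed form.

-- Written exactly as in `term`, so that `term n k` unfolds to `sgn k` times it.
magnitude : ℕ → ℕ → ℕ
magnitude n k = (n C k) * ((2 * k) C k) * ((2 * (n ∸ k)) C (n ∸ k)) * (((2 * n ∸ 3 * k) ∸ 1) C n + (2 * n ∸ 3 * k) C n)

-- For k ≤ n the summand is C(n,k)² times the super Catalan number times the bracket.
p^2t∣term : ∀ {p} → Prime p → ∀ s t n κ → p ^ (s + t) ℕ.∣ n → ¬ p ℕ.∣ κ →
  term n (κ * p ^ s) ≈ + 0 [mod p ^ (t + t) ]
p^2t∣term {p} pr s t n κ p^s+t∣n p∤κ = ≈-trans (*-cong-≈ (≈-refl {a = sgn k}) magnitude≈0) (≈-reflexive (ℤ.*-zeroʳ (sgn k)))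
  where
  k = κ * p ^ s
  instance
    p≢0 : NonZero p
    p≢0 = prime⇒nonZero pr
    p^s≢0 : NonZero (p ^ s)
    p^s≢0 = m^n≢0 p s
  shuffle : ∀ κ q c → κ * q * c ≡ q * (κ * c)
  shuffle = solve-∀
  -- Since n divides k C(n, k) with k = κpˢ, first pˢ and then κ can be cancelled.
  p^t∣C : p ^ t ℕ.∣ n C k
  p^t∣C = prime-power-cancelˡ t κ (n C k) pr p∤κ (ℕ.*-cancelˡ-∣ (p ^ s)
    (subst₂ ℕ._∣_ (^-distribˡ-+-* p s t) (shuffle κ (p ^ s) (n C k)) (ℕ.∣-trans p^s+t∣n (n∣k*nCk n k))))
  magnitude≈0 : + magnitude n k ≈ + 0 [mod p ^ (t + t) ]
  magnitude≈0 with k ≤? n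
  ... | no k≰n = ≈-reflexive (cong (λ z → + (z * ((2 * k) C k) * ((2 * (n ∸ k)) C (n ∸ k)) * ((2 * n ∸ 3 * k ∸ 1) C n + (2 * n ∸ 3 * k) C n)))
    (k>n⇒nCk≡0 (≰⇒> k≰n)))
  ... | yes k≤n = subst (λ z → + magnitude n k ≈ + 0 [mod z ]) (sym (^-distribˡ-+-* p t t))
    (≈-trans (≈-reflexive factor)
      -- Each of the two copies of C(n, k) supplies one pᵗ.
      (≈-trans (≈-*-0 {b = + 0} (≈-trans (*-cong-≈ {a = + X} {d = Y} (∣⇒≈0 p^t∣C) ≈-refl) (≈-reflexive (ℤ.*-zeroˡ Y))) (∣⇒≈0 p^t∣C))
        (≈-reflexive (ℤ.*-zeroˡ (+ X)))))
    where
    m = n ∸ k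
    n≡k+m : n ≡ k + m
    n≡k+m = sym (m+[n∸m]≡n k≤n)
    X = n C k
    E = (2 * n ∸ 3 * k ∸ 1) C n + (2 * n ∸ 3 * k) C n
    Y = superCatalan k m ℤ.* + E
    open ≡-Reasoning
    arrange : ∀ x s e → x ℤ.* (s ℤ.* x) ℤ.* e ≡ x ℤ.* (s ℤ.* e) ℤ.* x
    arrange = solveℤ-∀
    factor : + magnitude n k ≡ + X ℤ.* Y ℤ.* + X
    factor = begin
      + (X * ((2 * k) C k) * ((2 * m) C m) * E)  ≡⟨ cong (λ z → + (z * E)) (*-assoc X _ _) ⟩
      + (X * (((2 * k) C k) * ((2 * m) C m)) * E)  ≡⟨ trans (pos-* (X * (((2 * k) C k) * ((2 * m) C m))) E) (cong (ℤ._* + E) (pos-* X (((2 * k) C k) * ((2 * m) C m)))) ⟩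
      + X ℤ.* + (((2 * k) C k) * ((2 * m) C m)) ℤ.* + E
        ≡⟨ cong (λ z → + X ℤ.* z ℤ.* + E) (trans (sym (centralC-product k m)) (cong (λ z → superCatalan k m ℤ.* + (z C k)) (sym n≡k+m))) ⟩
      + X ℤ.* (superCatalan k m ℤ.* + X) ℤ.* + E   ≡⟨ arrange (+ X) (superCatalan k m) (+ E) ⟩
      + X ℤ.* Y ℤ.* + X  ∎

NonZero-3k+2l : ∀ k l → .{{NonZero (k + l)}} → NonZero (3 * k + 2 * l)
NonZero-3k+2l (suc k) l = _
NonZero-3k+2l zero (suc l) = _

-- With N = 3k + 2l the bracket is (l + N)/N = 3(k + l)/N times C(N, n); the other factors are
-- factorial quotients. Multiplying out keeps the identity in ℕ.
magnitude-formula : ∀ k l → .{{NonZero (k + l)}} →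
  (3 * k + 2 * l) * (denominator _! k l * magnitude (3 * k + l) k) ≡ 3 * (k + l) * numerator _! k l
magnitude-formula k l = begin
  N * (den * (X₁ * X₂ * ((2 * (n ∸ k)) C (n ∸ k)) * ((2 * n ∸ 3 * k ∸ 1) C n + (2 * n ∸ 3 * k) C n)))
    ≡⟨ cong₂ (λ a b → N * (den * (X₁ * X₂ * ((2 * a) C a) * ((b ∸ 1) C n + b C n)))) n∸k≡m 2n∸3k≡N ⟩
  N * (den * (X₁ * X₂ * X₃ * (X₅ + X₄)))
    ≡⟨ arrange N (k !) (m !) (l !) X₁ X₂ X₃ X₄ X₅ ⟩
  (X₁ * (k ! * m !)) * (X₂ * (k ! * k !)) * (X₃ * (m ! * m !)) * l ! * (N * X₅ + N * X₄)
    ≡⟨ cong₂ _*_ (cong (_* l !) (cong₂ _*_ (cong₂ _*_ X₁-! (centralC-! k)) (centralC-! m))) (cong (λ z → z + N * X₄) N*X₅) ⟩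
  n ! * (2 * k) ! * (2 * m) ! * l ! * (l * X₄ + N * X₄)
    ≡⟨ arrange′ k l (n !) ((2 * k) !) ((2 * m) !) (l !) X₄ ⟩
  3 * (k + l) * ((2 * k) ! * (2 * m) ! * (X₄ * (n ! * l !)))
    ≡⟨ cong (λ z → 3 * (k + l) * ((2 * k) ! * (2 * m) ! * z)) X₄-! ⟩
  3 * (k + l) * numerator _! k l ∎
  where
  open ≡-Reasoning
  n = 3 * k + l
  m = 2 * k + l
  N = 3 * k + 2 * l
  den = denominator _! k l
  X₁ = n C k
  X₂ = (2 * k) C k
  X₃ = (2 * m) C m
  X₄ = N C n
  X₅ = (N ∸ 1) C n
  instance _ = NonZero-3k+2l k l
  n≡k+m : ∀ k l → 3 * k + l ≡ k + (2 * k + l)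
  n≡k+m = solve-∀
  2n≡3k+N : ∀ k l → 2 * (3 * k + l) ≡ 3 * k + (3 * k + 2 * l)
  2n≡3k+N = solve-∀
  N≡n+l : ∀ k l → 3 * k + 2 * l ≡ 3 * k + l + l
  N≡n+l = solve-∀
  n∸k≡m : n ∸ k ≡ m
  n∸k≡m = trans (cong (_∸ k) (n≡k+m k l)) (m+n∸m≡n k m)
  2n∸3k≡N : 2 * n ∸ 3 * k ≡ N
  2n∸3k≡N = trans (cong (_∸ 3 * k) (2n≡3k+N k l)) (m+n∸m≡n (3 * k) N)
  X₁-! : X₁ * (k ! * m !) ≡ n !
  X₁-! = trans (cong (λ z → (z C k) * (k ! * m !)) (n≡k+m k l)) (trans (C-! k m) (cong _! (sym (n≡k+m k l))))
  X₄-! : X₄ * (n ! * l !) ≡ N !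
  X₄-! = trans (cong (λ z → (z C n) * (n ! * l !)) (N≡n+l k l)) (trans (C-! n l) (cong _! (sym (N≡n+l k l))))
  N*X₅ : N * X₅ ≡ l * X₄
  N*X₅ = subst (λ z → z * X₅ ≡ l * (z C n)) (suc-pred N) (C-lower-suc n l (pred N) (trans (suc-pred N) (N≡n+l k l)))
  arrange : ∀ N f g h a b c d e → N * (f * f * f * (g * g * g) * h * (a * b * c * (e + d)))
    ≡ (a * (f * g)) * (b * (f * f)) * (c * (g * g)) * h * (N * e + N * d)
  arrange = solve-∀
  arrange′ : ∀ k l n a b h x → n * a * b * h * (l * x + (3 * k + 2 * l) * x) ≡ 3 * (k + l) * (a * b * (x * (n * h)))
  arrange′ = solve-∀

-- The powers of p cancel because numerator and denominator both have total argument 9k + 4l.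
magnitude-scale : ∀ o k l → .{{NonZero (k + l)}} →
  denominator (unitFactorial o) k l * magnitude (suc o * (3 * k + l)) (suc o * k)
    ≡ numerator (unitFactorial o) k l * magnitude (3 * k + l) k
-- The closed form is used at (pk, pl) and, backwards, at (k, l); the cancelled factor gathers what
-- the two have in common.
magnitude-scale o k l = *-cancelˡ-≡ _ _ (p * ((3 * k + 2 * l) * (numerator (p ^_) k l * denominator _! k l))) (begin
  p * (N * (numerator (p ^_) k l * d)) * (A * M′)
    ≡⟨ cong (λ z → p * (N * (z * d)) * (A * M′)) (sym powers) ⟩
  p * (N * (denominator (p ^_) k l * d)) * (A * M′)
    ≡⟨ arrange p k l (denominator (p ^_) k l) d A M′ ⟩
  (3 * (p * k) + 2 * (p * l)) * (denominator (p ^_) k l * d * A * M′)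
    ≡⟨ cong₂ (λ x y → (3 * (p * k) + 2 * (p * l)) * (x * y)) (sym den-scale) (cong (λ z → magnitude z (p * k)) (n-scale p k l)) ⟩
  (3 * (p * k) + 2 * (p * l)) * (denominator _! (p * k) (p * l) * magnitude (3 * (p * k) + p * l) (p * k))
    ≡⟨ magnitude-formula (p * k) (p * l) ⟩
  3 * (p * k + p * l) * numerator _! (p * k) (p * l)
    ≡⟨ cong (3 * (p * k + p * l) *_) num-scale ⟩
  3 * (p * k + p * l) * (numerator (p ^_) k l * e * B)
    ≡⟨ arrange′ p k l (numerator (p ^_) k l) e B ⟩
  p * numerator (p ^_) k l * B * (3 * (k + l) * e)
    ≡⟨ cong (p * numerator (p ^_) k l * B *_) (sym (magnitude-formula k l)) ⟩
  p * numerator (p ^_) k l * B * (N * (d * M))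
    ≡⟨ arrange″ p N (numerator (p ^_) k l) d B M ⟩
  p * (N * (numerator (p ^_) k l * d)) * (B * M) ∎)
  where
  open ≡-Reasoning
  p = suc o
  N = 3 * k + 2 * l
  A = denominator (unitFactorial o) k l
  B = numerator (unitFactorial o) k l
  d = denominator _! k l
  e = numerator _! k l
  M = magnitude (3 * k + l) k
  M′ = magnitude (p * (3 * k + l)) (p * k)
  n-scale : ∀ p k l → p * (3 * k + l) ≡ 3 * (p * k) + p * l
  n-scale = solve-∀
  arg₁ : ∀ p k → 2 * (p * k) ≡ p * (2 * k)
  arg₁ = solve-∀
  arg₂ : ∀ p k l → 2 * (2 * (p * k) + p * l) ≡ p * (2 * (2 * k + l))
  arg₂ = solve-∀
  arg₃ : ∀ p k l → 3 * (p * k) + 2 * (p * l) ≡ p * (3 * k + 2 * l)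
  arg₃ = solve-∀
  arg₄ : ∀ p k l → 2 * (p * k) + p * l ≡ p * (2 * k + l)
  arg₄ = solve-∀
  f : ∀ {x} y → x ≡ p * y → x ! ≡ p ^ y * y ! * unitFactorial o y
  f y refl = [p*a]!≡p^a*a!*unitFactorial o y
  cube : ∀ {x y : ℕ} → x ≡ y → x * x * x ≡ y * y * y
  cube refl = refl
  collect₃ : ∀ a b c a′ b′ c′ a″ b″ c″ → a * b * c * (a′ * b′ * c′) * (a″ * b″ * c″) ≡ a * a′ * a″ * (b * b′ * b″) * (c * c′ * c″)
  collect₃ = solve-∀
  collect₇ : ∀ a b c a′ b′ c′ a″ b″ c″ →
    a * b * c * (a * b * c) * (a * b * c) * (a′ * b′ * c′ * (a′ * b′ * c′) * (a′ * b′ * c′)) * (a″ * b″ * c″)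
      ≡ a * a * a * (a′ * a′ * a′) * a″ * (b * b * b * (b′ * b′ * b′) * b″) * (c * c * c * (c′ * c′ * c′) * c″)
  collect₇ = solve-∀
  num-scale : numerator _! (p * k) (p * l) ≡ numerator (p ^_) k l * e * B
  num-scale = trans (cong₂ _*_ (cong₂ _*_ (f (2 * k) (arg₁ p k)) (f (2 * (2 * k + l)) (arg₂ p k l))) (f N (arg₃ p k l)))
    (collect₃ (p ^ (2 * k)) _ _ (p ^ (2 * (2 * k + l))) _ _ (p ^ N) _ _)
  den-scale : denominator _! (p * k) (p * l) ≡ denominator (p ^_) k l * d * A
  den-scale = trans (cong₂ _*_ (cong₂ _*_ (cube (f k refl)) (cube (f (2 * k + l) (arg₄ p k l)))) (f l refl))
    (collect₇ (p ^ k) _ _ (p ^ (2 * k + l)) _ _ (p ^ l) _ _)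
  _⊕_ : ∀ {x y i j} → x ≡ p ^ i → y ≡ p ^ j → x * y ≡ p ^ (i + j)
  _⊕_ {i = i} {j} refl refl = sym (^-distribˡ-+-* p i j)
  degrees : ∀ k l → k + k + k + (2 * k + l + (2 * k + l) + (2 * k + l)) + l ≡ 2 * k + 2 * (2 * k + l) + (3 * k + 2 * l)
  degrees = solve-∀
  powers : denominator (p ^_) k l ≡ numerator (p ^_) k l
  powers = trans (_⊕_ {i = k + k + k + (m + m + m)} {l} (_⊕_ {i = k + k + k} {m + m + m} (r k) (r m)) refl)
    (trans (cong (p ^_) (degrees k l)) (sym (_⊕_ {i = 2 * k + 2 * m} {N} (_⊕_ {i = 2 * k} {2 * m} refl refl) refl)))
    where
    m = 2 * k + l
    r : ∀ x → p ^ x * p ^ x * p ^ x ≡ p ^ (x + x + x)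
    r x = _⊕_ {i = x + x} {x} (_⊕_ {i = x} {x} refl refl) refl
  arrange : ∀ p k l z d A M → p * ((3 * k + 2 * l) * (z * d)) * (A * M) ≡ (3 * (p * k) + 2 * (p * l)) * (z * d * A * M)
  arrange = solve-∀
  arrange′ : ∀ p k l z e B → 3 * (p * k + p * l) * (z * e * B) ≡ p * z * B * (3 * (k + l) * e)
  arrange′ = solve-∀
  arrange″ : ∀ p N z d B M → p * z * B * (N * (d * M)) ≡ p * (N * (z * d)) * (B * M)
  arrange″ = solve-∀
  NonZero-* : ∀ {x y} → NonZero x → NonZero y → NonZero (x * y)
  NonZero-* {x} {y} a b = m*n≢0 x y {{a}} {{b}}
  instance
    NonZero-scaled : NonZero (p * k + p * l)
    NonZero-scaled = subst NonZero (*-distribˡ-+ p k l) (m*n≢0 p (k + l))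
    NonZero-factor : NonZero (p * (N * (numerator (p ^_) k l * d)))
    NonZero-factor = NonZero-* {p} _ (NonZero-* (NonZero-3k+2l k l) (NonZero-*
      (NonZero-* (NonZero-* (m^n≢0 p (2 * k)) (m^n≢0 p (2 * (2 * k + l)))) (m^n≢0 p N))
      (NonZero-* (NonZero-* (cube≢0 k) (cube≢0 (2 * k + l))) (l !≢0))))
      where
      cube≢0 : ∀ x → NonZero (x ! * x ! * x !)
      cube≢0 x = NonZero-* (NonZero-* (x !≢0) (x !≢0)) (x !≢0)

denominator-∤ : ∀ o → Prime (suc o) → ∀ k l → ¬ suc o ℕ.∣ denominator (unitFactorial o) k l
denominator-∤ o pr k l = (cube k ⊗ cube (2 * k + l)) ⊗ F l
  where
  F = unitFactorial-∤ o pr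
  infixl 7 _⊗_
  _⊗_ : ∀ {a b} → ¬ suc o ℕ.∣ a → ¬ suc o ℕ.∣ b → ¬ suc o ℕ.∣ a * b
  _⊗_ = prime-∤-* pr
  cube : ∀ x → ¬ suc o ℕ.∣ unitFactorial o x * unitFactorial o x * unitFactorial o x
  cube x = F x ⊗ F x ⊗ F x

-- As 0 < n < 3k, the possibly truncated difference 2n - 3k is below n, so both binomials of the
-- bracket are 0.
term-vanishes : ∀ n k → .{{NonZero n}} → n < 3 * k → term n k ≡ + 0
term-vanishes n k n<3k = trans (cong (λ z → sgn k ℤ.* + z) magnitude≡0) (ℤ.*-zeroʳ (sgn k))
  where
  below : 2 * n ∸ 3 * k < n
  below = ≤-<-trans (∸-monoʳ-≤ (2 * n) n<3k) (subst (_< n) (sym (2n∸[1+n] n)) (≤-reflexive (suc-pred n)))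
    where
    2n∸[1+n] : ∀ n → 2 * n ∸ suc n ≡ pred n
    2n∸[1+n] zero = refl
    2n∸[1+n] (suc n) = trans (cong (_∸ suc n) (+-suc n (n + 0))) (trans (cong (λ z → suc (n + z) ∸ suc n) (+-identityʳ n)) (m+n∸m≡n n n))
  magnitude≡0 : magnitude n k ≡ 0
  magnitude≡0 = trans (cong₂ (λ a b → (n C k) * ((2 * k) C k) * ((2 * (n ∸ k)) C (n ∸ k)) * (a + b))
    (k>n⇒nCk≡0 (≤-<-trans (m∸n≤m _ 1) below)) (k>n⇒nCk≡0 below)) (*-zeroʳ ((n C k) * ((2 * k) C k) * ((2 * (n ∸ k)) C (n ∸ k))))

-- Comparison of the terms at (n, k) and (pn, pk).

numerator-∘-* : ∀ φ q k l → numerator (λ x → φ (x * q)) k l ≡ numerator φ (k * q) (l * q)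
numerator-∘-* φ q k l = cong₂ _*_ (cong₂ _*_ (cong φ (arg₁ k q)) (cong φ (arg₂ k l q))) (cong φ (arg₃ k l q))
  where
  arg₁ : ∀ k q → 2 * k * q ≡ 2 * (k * q)
  arg₁ = solve-∀
  arg₂ : ∀ k l q → 2 * (2 * k + l) * q ≡ 2 * (2 * (k * q) + l * q)
  arg₂ = solve-∀
  arg₃ : ∀ k l q → (3 * k + 2 * l) * q ≡ 3 * (k * q) + 2 * (l * q)
  arg₃ = solve-∀

denominator-∘-* : ∀ φ q k l → denominator (λ x → φ (x * q)) k l ≡ denominator φ (k * q) (l * q)
denominator-∘-* φ q k l = cong (λ z → φ (k * q) * φ (k * q) * φ (k * q) * (φ z * φ z * φ z) * φ (l * q)) (arg k l q)
  where
  arg : ∀ k l q → (2 * k + l) * q ≡ 2 * (k * q) + l * q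
  arg = solve-∀

-- Passing from (n, k) to (pn, pk) multiplies the term by a unit ≡ 1 modulo p^(2s+2), for k = κpˢ,
-- and the term itself is divisible by p^(2t), where s + t = R.
term-scale : ∀ o → Prime (suc o) → ∀ m R .{{_ : NonZero m}} k →
  term (suc o * (m * suc o ^ R)) (suc o * k) ≈ term (m * suc o ^ R) k [mod suc o ^ (suc R + suc R) ]
term-scale o pr m R k with 3 * k ≤? m * suc o ^ R
... | no 3k≰n = ≈-reflexive (trans
    (term-vanishes (p * n) (p * k) (subst (p * n <_) (swap p k) (*-monoʳ-< p (≰⇒> 3k≰n))))
    (sym (term-vanishes n k (≰⇒> 3k≰n))))
  where
  p = suc o
  n = m * p ^ R
  swap : ∀ p k → p * (3 * k) ≡ 3 * (p * k)
  swap = solve-∀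
  instance
    n≢0 : NonZero n
    n≢0 = m*n≢0 m (p ^ R) {{it}} {{m^n≢0 p R}}
    pn≢0 : NonZero (p * n)
    pn≢0 = m*n≢0 p n
... | yes 3k≤n with capped-valuation (suc o) R k
-- Since s ≤ R, pˢ divides n as well as k; dividing 3k ≤ n by it gives 3κ + l = m pᵗ.
...   | s , t , κ , refl , refl , t≡0⊎p∤κ with m≤n⇒∃[o]m+o≡n 3κ≤mp^t
  where
  open ≤-Reasoning
  p = suc o
  instance _ = m^n≢0 p s
  3κ≤mp^t : 3 * κ ≤ m * p ^ t
  3κ≤mp^t = *-cancelʳ-≤ (3 * κ) (m * p ^ t) (p ^ s) (begin
    3 * κ * p ^ s        ≡⟨ *-assoc 3 κ (p ^ s) ⟩
    3 * (κ * p ^ s)      ≤⟨ 3k≤n ⟩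
    m * p ^ (s + t)      ≡⟨ cong (m *_) (trans (^-distribˡ-+-* p s t) (*-comm (p ^ s) (p ^ t))) ⟩
    m * (p ^ t * p ^ s)  ≡⟨ sym (*-assoc m (p ^ t) (p ^ s)) ⟩
    m * p ^ t * p ^ s    ∎)
-- A is prime to p, and A times the term at (pn, pk) is B ε^κ times the term at (n, k). Now B ε^κ ≡
-- A modulo p^(2s+2), and the term at (n, k) supplies the other p^(2t).
...     | l , 3κ+l≡mp^t = ≈-cancelˡ (suc (s + t) + suc (s + t)) A pr (denominator-∤ o pr K L)
  (subst (λ z → + A ℤ.* term (p * n) (p * K) ≈ + A ℤ.* term n K [mod z ]) modulus
    (≈-trans (≈-reflexive scaled) (≈-*-0 (subst₂ (λ a b → + a ℤ.* ε ℤ.^ κ ≈ + b [mod p ^ (suc s + suc s) ])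
      (numerator-∘-* (unitFactorial o) q κ l) (denominator-∘-* (unitFactorial o) q κ l)
      (numerator≈denominator sign κ l)) term≈0)))
  where
  open ≡-Reasoning
  p = suc o
  q = p ^ s
  n = m * p ^ (s + t)
  K = κ * q
  L = l * q
  A = denominator (unitFactorial o) K L
  B = numerator (unitFactorial o) K L
  sign : BlockSign o s
  sign = blockSign o s pr
  open BlockSign sign
  modulus : p ^ (suc s + suc s) * p ^ (t + t) ≡ p ^ (suc (s + t) + suc (s + t))
  modulus = trans (sym (^-distribˡ-+-* p (suc s + suc s) (t + t))) (cong (p ^_) (exponent s t))
    where
    exponent : ∀ s t → suc s + suc s + (t + t) ≡ suc (s + t) + suc (s + t)
    exponent = solve-∀
  3K+L≡n : 3 * K + L ≡ n
  3K+L≡n = begin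
    3 * (κ * q) + l * q  ≡⟨ factor κ l q ⟩
    (3 * κ + l) * q      ≡⟨ cong (_* q) 3κ+l≡mp^t ⟩
    m * p ^ t * q        ≡⟨ *-assoc m (p ^ t) q ⟩
    m * (p ^ t * q)      ≡⟨ cong (m *_) (trans (*-comm (p ^ t) q) (sym (^-distribˡ-+-* p s t))) ⟩
    n                    ∎
    where
    factor : ∀ κ l q → 3 * (κ * q) + l * q ≡ (3 * κ + l) * q
    factor = solve-∀
  K+L≢0 : NonZero (K + L)
  K+L≢0 = ≢-nonZero λ K+L≡0 → ≢-nonZero⁻¹ n {{m*n≢0 m (p ^ (s + t)) {{it}} {{m^n≢0 p (s + t)}}}}
    (trans (sym 3K+L≡n) (cong₂ (λ a b → 3 * a + b) (m+n≡0⇒m≡0 K K+L≡0) (m+n≡0⇒n≡0 K K+L≡0)))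
  term≈0 : term n K ≈ + 0 [mod p ^ (t + t) ]
  -- For t = 0 the modulus is 1.
  term≈0 = [ (λ { refl → modulo (term n K) (sym (trans (ℤ.+-identityˡ _) (ℤ.*-identityʳ _))) })
           , p^2t∣term pr s t n κ (ℕ.n∣m*n m) ]′ t≡0⊎p∤κ
  arrange : ∀ a s x → a ℤ.* (s ℤ.* x) ≡ s ℤ.* (a ℤ.* x)
  arrange = solveℤ-∀
  arrange′ : ∀ s e b x → s ℤ.* e ℤ.* (b ℤ.* x) ≡ b ℤ.* e ℤ.* (s ℤ.* x)
  arrange′ = solveℤ-∀
  scaled : + A ℤ.* term (p * n) (p * K) ≡ + B ℤ.* ε ℤ.^ κ ℤ.* term n K
  scaled = begin
    + A ℤ.* (sgn (p * K) ℤ.* + magnitude (p * n) (p * K))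
      ≡⟨ arrange (+ A) (sgn (p * K)) (+ magnitude (p * n) (p * K)) ⟩
    sgn (p * K) ℤ.* (+ A ℤ.* + magnitude (p * n) (p * K))
      ≡⟨ cong (sgn (p * K) ℤ.*_) (trans (sym (pos-* A (magnitude (p * n) (p * K))))
           (trans (cong +_ (subst (λ z → A * magnitude (p * z) (p * K) ≡ B * magnitude z K) 3K+L≡n
             (magnitude-scale o K L {{K+L≢0}}))) (pos-* B (magnitude n K)))) ⟩
    sgn (p * K) ℤ.* (+ B ℤ.* + magnitude n K)
      ≡⟨ cong (ℤ._* (+ B ℤ.* + magnitude n K)) (sym (sgn-scale κ)) ⟩
    sgn K ℤ.* ε ℤ.^ κ ℤ.* (+ B ℤ.* + magnitude n K)
      ≡⟨ arrange′ (sgn K) (ε ℤ.^ κ) (+ B) (+ magnitude n K) ⟩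
    + B ℤ.* ε ℤ.^ κ ℤ.* term n K ∎

-- Summation over the multiples of p.

module _ {M o : ℕ} {f g : ℕ → ℤ}
         (f≈0 : ∀ k → ¬ suc o ℕ.∣ k → f k ≈ + 0 [mod M ])
         (f≈g : ∀ k → f (suc o * k) ≈ g k [mod M ]) where

  -- Lowering b drops a term whose index is not a multiple of p; at b = 0 the term at index ap is
  -- matched with `g a`.
  sumTo-+-multiples : ∀ a b → b ≤ o → sumTo (b + a * suc o) f ≈ sumTo a g [mod M ]
  sumTo-+-multiples zero zero _ = subst (λ z → f z ≈ g 0 [mod M ]) (*-zeroʳ (suc o)) (f≈g 0)
  -- `suc a * suc o` computes to `suc (o + a * suc o)`, so the remaining sum restarts with b = o.
  sumTo-+-multiples (suc a) zero _ = +-cong-≈ (sumTo-+-multiples a o ≤-refl)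
    (subst (λ z → f z ≈ g (suc a) [mod M ]) (*-comm (suc o) (suc a)) (f≈g (suc a)))
  sumTo-+-multiples a (suc b) b<o = ≈-trans
    (+-cong-≈ (sumTo-+-multiples a b (<⇒≤ b<o)) (f≈0 (suc b + a * suc o)
      λ d → ℕ.>⇒∤ (s≤s b<o) (ℕ.∣m+n∣m⇒∣n (subst (suc o ℕ.∣_) (+-comm (suc b) (a * suc o)) d) (ℕ.n∣m*n a))))
    (≈-reflexive (ℤ.+-identityʳ (sumTo a g)))

  sumTo-multiples : ∀ N → sumTo N f ≈ sumTo (N / suc o) g [mod M ]
  sumTo-multiples N = subst (λ z → sumTo z f ≈ sumTo (N / suc o) g [mod M ]) (sym (m≡m%n+[m/n]*n N (suc o)))
    (sumTo-+-multiples (N / suc o) (N % suc o) (s≤s⁻¹ (m%n<n N (suc o))))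

s18-nonZero : ∀ n .{{_ : NonZero n}} → s18 n ≡ sumTo (n / 3) (term n)
s18-nonZero (suc n) = refl

-- With n = m p^R, the terms of s18(pn) at indices prime to p vanish and those at pk match the terms
-- of s18(n). The ranges agree because dividing pn by 3 and then by p, rounding down each time,
-- gives the floor of n/3.
s18-supercongruence : ∀ o → Prime (suc o) → ∀ m R .{{_ : NonZero m}} →
  s18 (m * suc o ^ suc R) ≈ s18 (m * suc o ^ R) [mod suc o ^ (suc R + suc R) ]
s18-supercongruence o pr m R = ≈-trans
  (≈-reflexive (trans (cong s18 (swap m p (p ^ R))) (s18-nonZero (p * n))))
  (≈-trans (sumTo-multiples vanish (term-scale o pr m R) (p * n / 3))
    (≈-reflexive (trans (cong (λ z → sumTo z (term n)) quotient) (sym (s18-nonZero n)))))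
  where
  p = suc o
  n = m * p ^ R
  instance
    n≢0 : NonZero n
    n≢0 = m*n≢0 m (p ^ R) {{it}} {{m^n≢0 p R}}
    pn≢0 : NonZero (p * n)
    pn≢0 = m*n≢0 p n
    3p≢0 : NonZero (3 * p)
    3p≢0 = m*n≢0 3 p
    p3≢0 : NonZero (p * 3)
    p3≢0 = m*n≢0 p 3
  swap : ∀ m p q → m * (p * q) ≡ p * (m * q)
  swap = solve-∀
  vanish : ∀ k → ¬ p ℕ.∣ k → term (p * n) k ≈ + 0 [mod p ^ (suc R + suc R) ]
  -- Here s = 0 and κ = k, so the whole power p^(R+1) in pn counts.
  vanish k p∤k = subst (λ z → term (p * n) z ≈ + 0 [mod p ^ (suc R + suc R) ]) (*-identityʳ k)
    (p^2t∣term pr 0 (suc R) (p * n) k (ℕ.*-monoʳ-∣ p (ℕ.n∣m*n m)) p∤k)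
  quotient : p * n / 3 / p ≡ n / 3
  quotient = trans (m/n/o≡m/[n*o] (p * n) 3 p) (trans (/-congʳ {m = p * n} (*-comm 3 p)) (m*n/m*o≡n/o p n 3))

theorem1p3 : ∀ (m r p : ℕ) → m ≥ 1 → r ≥ 1 → Prime p →
    (+ (p ^ (2 * r))) ∣ (s18 (m * p ^ r) - s18 (m * p ^ (r ∸ 1)))
theorem1p3 m (suc R) zero m≥1 r≥1 pr = ⊥-elim (¬prime[0] pr)
theorem1p3 m (suc R) (suc o) m≥1 r≥1 pr =
  subst (λ e → + (suc o ^ e) ∣ s18 (m * suc o ^ suc R) - s18 (m * suc o ^ R))
    (cong (λ z → suc R + z) (sym (+-identityʳ (suc R))))
    (≈⇒∣ (s18-supercongruence o pr m R {{>-nonZero m≥1}}))
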